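{- Let $\mathbf{u}$ be an infinite word over a ternary alphabet $\mathcal{A}$ whose language $\mathcal{L}(\mathbf{u})$ is closed under reversal. If the complexity of $\mathbf{u}$ satisfies $\mathcal{C}(n)=2n+1$ for every $n\in\mathbb{N}$, then $\mathbf{u}$ has the property $\mathcal{P}$, i.e. $\mathcal{P}(n)+\mathcal{P}(n+1)=1+\#\mathcal{A}=4$ for every $n\in\mathbb{N}$.
   Context: $\mathbb{N}$ includes $0$. The language $\mathcal{L}(\mathbf{u})$ of an infinite word $\mathbf{u}=u_0u_1u_2\ldots$ is the set of all its finite factors (contiguous subwords), including the empty word; $\mathcal{L}_n(\mathbf{u})$ is the set of factors of length $n$. The complexity is $\mathcal{C}(n)=\#\mathcal{L}_n(\mathbf{u})$. The reversal of $w=w_0\cdots w_{n-1}$ is $\overline{w}=w_{n-1}\cdots w_0$; a palindrome is a word with $w=\overline{w}$. $\mathcal{L}(\mathbf{u})$ is closed under reversal if $w\in\mathcal{L}(\mathbf{u})$ implies $\overline{w}\in\mathcal{L}(\mathbf{u})$. $\mathcal{P}(n)$ denotes the number of palindromic factors of length $n$ in $\mathcal{L}(\mathbf{u})$. -}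

module Defs where

open import Data.Nat using (ℕ; _+_)
open import Data.Fin using (Fin; toℕ)
open import Data.Vec using (Vec; tabulate; reverse)
open import Data.List using (List; length)
open import Data.List.Membership.Propositional using (_∈_)
open import Data.List.Relation.Unary.Unique.Propositional using (Unique)
open import Data.Product using (Σ; _×_; ∃)
open import Function.Bundles using (_⇔_)
open import Relation.Binary.PropositionalEquality using (_≡_)
open import Level using (Level; _⊔_; suc)

Alphabet : Set
Alphabet = Fin 3

Word : Set
Word = ℕ → Alphabet

FinWord : ℕ → Set
FinWord n = Vec Alphabet n

Factor : Word → (n : ℕ) → FinWord n → Set
Factor u n w = ∃ λ (i : ℕ) → w ≡ tabulate (λ j → u (i + toℕ j))

IsPalindrome : ∀ {n} → FinWord n → Set
IsPalindrome w = reverse w ≡ w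

ClosedUnderReversal : Word → Set
ClosedUnderReversal u = ∀ n (w : FinWord n) → Factor u n w → Factor u n (reverse w)

HasCard : ∀ {a p} {A : Set a} → (A → Set p) → ℕ → Set (a ⊔ p)
HasCard {A = A} P k =
  Σ (List A) λ xs → (length xs ≡ k) × Unique xs × (∀ x → (x ∈ xs) ⇔ P x)

Complexity : Word → ℕ → ℕ → Set
Complexity u n k = HasCard (Factor u n) k

PalComplexity : Word → ℕ → ℕ → Set
PalComplexity u n k = HasCard (λ (w : FinWord n) → Factor u n w × IsPalindrome w) k

{-# OPTIONS --safe #-}
-- Upper bound. Identify every word with its reversal. The Rauzy graph of order n becomes an
-- undirected graph with (C(n) + P(n)) / 2 vertices, in which the palindromes of length n + 1 are
-- loops and the other factors of length n + 1 give (C(n+1) - P(n+1)) / 2 edges. The word u walks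
-- through this graph, and each newly visited vertex is entered by a newly visited edge that is not
-- a loop; hence P(n) + P(n+1) ≤ C(n+1) - C(n) + 2 = 4. As the non-palindromic factors of length n
-- come in pairs, P(n) ≡ C(n) ≡ 1 mod 2, so (P(n), P(n+1)) is (1,1), (1,3) or (3,1).
--
-- Lower bound. If P(n) = 3 and P(n+2) = 1, two palindromes w₁ ≠ w₂ of length n have no extension
-- a w a in the language. Both are right special, and as C(n+1) - C(n) = 2 they are the only right
-- special factors of length n and have exactly two extensions each. Then no factor of length n + 1
-- is right special, against C(n+2) > C(n+1). So (1,1) never occurs, by induction from
-- (P(0), P(1)) = (1,3).
module Submission where

open import Defs
open import Data.Empty using (⊥; ⊥-elim)
open import Data.Nat using (ℕ; zero; suc; _+_; _*_; _≤_; _<_; _⊔_; z≤n; s≤s)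
open import Data.Nat.Properties
open import Data.Nat.Solver using (module +-*-Solver)
open import Data.Fin using (zero; toℕ) renaming (_≟_ to _≟ᶠ_)
open import Data.Vec using ([]; _∷_; _∷ʳ_; reverse; tabulate; init; tail; initLast)
open import Data.Vec.Properties using (≡-dec; reverse-∷; reverse-involutive; reverse-reverse;
  ∷ʳ-injective; ∷ʳ-injectiveˡ; init-∷ʳ; tabulate-cong)
open import Data.List using (List; []; _∷_; length; map)
open import Data.List.Properties using (length-map)
open import Data.List.Membership.Propositional using (_∈_; _∉_)
open import Data.List.Membership.Propositional.Properties using (∈-∃++; ∈-map⁻)
open import Data.List.Relation.Binary.Permutation.Propositional.Properties using (shift; ↭-length)
open import Data.List.Relation.Binary.Subset.Propositional using (_⊆_)
open import Data.List.Relation.Binary.Subset.Propositional.Properties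
  using (⊆∷∧∉⇒⊆; ⊆-trans; ⊆-reflexive-↭; ∈-∷⁺ʳ)
open import Data.List.Relation.Unary.All using ([]; _∷_)
open import Data.List.Relation.Unary.All.Properties using (¬Any⇒All¬)
open import Data.List.Relation.Unary.AllPairs using ([]; _∷_)
open import Data.List.Relation.Unary.Any using (here; there)
open import Data.List.Relation.Unary.Unique.Propositional using (Unique)
open import Data.List.Relation.Unary.Unique.Propositional.Properties
  using (map⁺; Unique[x∷xs]⇒x∉xs)
open import Data.Product using (Σ; ∃; _×_; _,_; proj₁; proj₂)
open import Data.Sum using (_⊎_; inj₁; inj₂)
open import Function using (_∘_)
open import Function.Bundles using (_⇔_; mk⇔; Equivalence)
open import Relation.Binary.Definitions using (DecidableEquality)
open import Relation.Binary.PropositionalEquality using (_≡_; _≢_; refl; sym; trans; cong; cong₂;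
  subst; subst₂; module ≡-Reasoning)
open import Relation.Nullary using (¬_; Dec; yes; no; contradiction)

-- Finite cardinalities

module _ {a} {A : Set a} where

  ∉⇒Unique : ∀ {x : A} {xs} → x ∉ xs → Unique xs → Unique (x ∷ xs)
  ∉⇒Unique x∉ uxs = ¬Any⇒All¬ _ x∉ ∷ uxs

  -- Pigeonhole: delete the head of `xs` from `ys`; by uniqueness the tail stays inside what
  -- remains.
  Unique∧⊆⇒length≤ : {xs ys : List A} → Unique xs → xs ⊆ ys → length xs ≤ length ys
  Unique∧⊆⇒length≤ {[]} _ _ = z≤n
  Unique∧⊆⇒length≤ {x ∷ xs} uxs@(_ ∷ uxs′) xs⊆ys with ∈-∃++ (xs⊆ys (here refl))
  ... | as , bs , refl = ≤-trans
    (s≤s (Unique∧⊆⇒length≤ uxs′ (⊆∷∧∉⇒⊆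
      (⊆-trans (xs⊆ys ∘ there) (⊆-reflexive-↭ (shift x as bs))) (Unique[x∷xs]⇒x∉xs uxs))))
    (≤-reflexive (sym (↭-length (shift x as bs))))

  module _ (_≟_ : DecidableEquality A) where
    open import Data.List.Membership.DecPropositional _≟_ using (_∈?_)

    -- An element of `ys` missing from `xs` could be put in front of `xs`, and the result would be
    -- too long to fit into `ys`.
    Unique∧⊆∧length≥⇒⊇ : {xs ys : List A} → Unique xs → xs ⊆ ys → length ys ≤ length xs → ys ⊆ xs
    Unique∧⊆∧length≥⇒⊇ {xs} uxs xs⊆ys ys≤xs {y} y∈ys with y ∈? xs
    ... | yes y∈xs = y∈xs
    ... | no  y∉xs = contradiction
      (≤-trans (Unique∧⊆⇒length≤ (∉⇒Unique y∉xs uxs) (∈-∷⁺ʳ y∈ys xs⊆ys)) ys≤xs) 1+n≰n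

  HasCard-unique : ∀ {p} {P : A → Set p} {k m} → HasCard P k → HasCard P m → k ≡ m
  HasCard-unique (xs , refl , uxs , xs⇔) (ys , refl , uys , ys⇔) = ≤-antisym
    (Unique∧⊆⇒length≤ uxs λ {x} → Equivalence.from (ys⇔ x) ∘ Equivalence.to (xs⇔ x))
    (Unique∧⊆⇒length≤ uys λ {y} → Equivalence.from (xs⇔ y) ∘ Equivalence.to (ys⇔ y))

  HasCard-resp-⇔ : ∀ {p q} {P : A → Set p} {Q : A → Set q} {k} →
    (∀ x → P x ⇔ Q x) → HasCard P k → HasCard Q k
  HasCard-resp-⇔ P⇔Q (xs , len , uxs , xs⇔) = xs , len , uxs , λ x → mk⇔
    (Equivalence.to (P⇔Q x) ∘ Equivalence.to (xs⇔ x))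
    (Equivalence.from (xs⇔ x) ∘ Equivalence.from (P⇔Q x))

-- Injectivity is asked on the list only, because the map of interest is `init`, which is injective
-- at best on factors.
Unique-map : ∀ {a b} {A : Set a} {B : Set b} {f : A → B} {xs} →
  (∀ {x y} → x ∈ xs → y ∈ xs → f x ≡ f y → x ≡ y) → Unique xs → Unique (map f xs)
Unique-map {xs = []} _ _ = []
Unique-map {f = f} {x ∷ xs} inj uxs@(_ ∷ uxs′) = ∉⇒Unique
  (λ fx∈ → let y , y∈ , eq = ∈-map⁻ f fx∈ in
    Unique[x∷xs]⇒x∉xs uxs (subst (_∈ xs) (sym (inj (here refl) (there y∈) eq)) y∈))
  (Unique-map (λ x∈ y∈ → inj (there x∈) (there y∈)) uxs′)

-- Words

_≟ʷ_ : ∀ {n} → DecidableEquality (FinWord n)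
_≟ʷ_ = ≡-dec _≟ᶠ_

module _ {n : ℕ} where
  open import Data.List.Membership.DecPropositional (_≟ʷ_ {n}) public using (_∈?_)

reverse-∷ʳ : ∀ {n} x (w : FinWord n) → reverse (w ∷ʳ x) ≡ x ∷ reverse w
reverse-∷ʳ x w = reverse-reverse
  (trans (reverse-∷ x (reverse w)) (cong (_∷ʳ x) (reverse-involutive w)))

palindrome-extension : ∀ {n} x {w : FinWord n} → IsPalindrome w → IsPalindrome (x ∷ (w ∷ʳ x))
palindrome-extension x {w} pal = begin
  reverse (x ∷ (w ∷ʳ x))  ≡⟨ reverse-∷ x (w ∷ʳ x) ⟩
  reverse (w ∷ʳ x) ∷ʳ x   ≡⟨ cong (_∷ʳ x) (reverse-∷ʳ x w) ⟩
  x ∷ (reverse w ∷ʳ x)    ≡⟨ cong (λ v → x ∷ (v ∷ʳ x)) pal ⟩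
  x ∷ (w ∷ʳ x)            ∎
  where open ≡-Reasoning

-- Symmetric l p k: the list l has no repetitions and consists of p palindromes and of k pairs of a
-- non-palindrome with its reversal.
data Symmetric {n} : List (FinWord n) → ℕ → ℕ → Set where
  []    : Symmetric [] 0 0
  palin : ∀ {w l p k} → IsPalindrome w → w ∉ l → Symmetric l p k → Symmetric (w ∷ l) (suc p) k
  pair  : ∀ {w l p k} → ¬ IsPalindrome w → w ∉ l → reverse w ∉ l →
          Symmetric l p k → Symmetric (w ∷ reverse w ∷ l) p (suc k)

module _ {n : ℕ} where

  Symmetric-reverse : ∀ {l p k} {w : FinWord n} → Symmetric l p k → w ∈ l → reverse w ∈ l
  Symmetric-reverse (palin pal _ _) (here refl) = here pal
  Symmetric-reverse (palin _ _ s) (there w∈) = there (Symmetric-reverse s w∈)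
  Symmetric-reverse (pair _ _ _ s) (here refl) = there (here refl)
  Symmetric-reverse (pair {w = w} _ _ _ s) (there (here refl)) = here (reverse-involutive w)
  Symmetric-reverse (pair _ _ _ s) (there (there w∈)) = there (there (Symmetric-reverse s w∈))

  Symmetric-reverse⁻ : ∀ {l p k} {w : FinWord n} → Symmetric l p k → reverse w ∈ l → w ∈ l
  Symmetric-reverse⁻ {l} {w = w} s rw∈ =
    subst (_∈ l) (reverse-involutive w) (Symmetric-reverse s rw∈)

  Symmetric-unique : ∀ {l p k} → Symmetric {n} l p k → Unique l
  Symmetric-unique [] = []
  Symmetric-unique (palin _ w∉ s) = ∉⇒Unique w∉ (Symmetric-unique s)
  Symmetric-unique (pair ¬pal w∉ rw∉ s) = ∉⇒Unique
    (λ { (here eq) → ¬pal (sym eq) ; (there w∈) → w∉ w∈ })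
    (∉⇒Unique rw∉ (Symmetric-unique s))

  Symmetric-length : ∀ {l p k} → Symmetric {n} l p k → length l ≡ p + 2 * k
  Symmetric-length [] = refl
  Symmetric-length (palin _ _ s) = cong suc (Symmetric-length s)
  Symmetric-length (pair {p = p} {k} _ _ _ s) = trans (cong (λ m → suc (suc m)) (Symmetric-length s))
    (solve 2 (λ p k → con 2 :+ (p :+ con 2 :* k) := p :+ con 2 :* (con 1 :+ k)) refl p k)
    where open +-*-Solver

  Symmetric-palindromes : ∀ {l p k} → Symmetric {n} l p k →
    HasCard (λ w → w ∈ l × IsPalindrome w) p
  Symmetric-palindromes [] = [] , refl , [] , λ _ → mk⇔ (λ ()) (λ ())
  Symmetric-palindromes (palin {w} pal w∉ s) with Symmetric-palindromes s
  ... | xs , len , uxs , xs⇔ =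
    w ∷ xs , cong suc len , ∉⇒Unique (w∉ ∘ proj₁ ∘ Equivalence.to (xs⇔ w)) uxs , λ v → mk⇔
      (λ { (here refl) → here refl , pal
         ; (there v∈) → let v∈l , pv = Equivalence.to (xs⇔ v) v∈ in there v∈l , pv })
      (λ { (here refl , _) → here refl
         ; (there v∈ , pv) → there (Equivalence.from (xs⇔ v) (v∈ , pv)) })
  Symmetric-palindromes (pair {w} ¬pal w∉ rw∉ s) with Symmetric-palindromes s
  ... | xs , len , uxs , xs⇔ = xs , len , uxs , λ v → mk⇔
      (λ v∈ → let v∈l , pv = Equivalence.to (xs⇔ v) v∈ in there (there v∈l) , pv)
      (λ { (here refl , pv) → contradiction pv ¬pal
         -- If `reverse w` is a palindrome, then so is `w`, as `reverse` is an involution.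
         ; (there (here refl) , pv) →
             contradiction (sym (trans (sym (reverse-involutive w)) pv)) ¬pal
         ; (there (there v∈) , pv) → Equivalence.from (xs⇔ v) (v∈ , pv) })

-- The effect of adding `w` and its reversal: one more orbit. `pairs` serves for an edge that may be
-- a loop, `new-pair` for an edge that leads to a new vertex.
record Insertion {n} (w : FinWord n) (l : List (FinWord n)) (p k : ℕ) : Set where
  field
    {l′}      : List (FinWord n)
    {p′ k′}   : ℕ
    symmetric : Symmetric l′ p′ k′
    orbits    : p′ + k′ ≡ suc (p + k)
    pairs     : k ≤ k′
    new-pair  : ¬ IsPalindrome w → k′ ≡ suc k
    old⊆      : l ⊆ l′
    new∈      : w ∈ l′
    ⊆old      : ∀ {v} → v ∈ l′ → v ∈ l ⊎ v ≡ w ⊎ v ≡ reverse w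

insert : ∀ {n} (w : FinWord n) {l p k} → w ∉ l → Symmetric l p k → Insertion w l p k
insert w {l} {p} {k} w∉ s with reverse w ≟ʷ w
... | yes pal = record
  { symmetric = palin pal w∉ s
  ; orbits    = refl
  ; pairs     = ≤-refl
  ; new-pair  = contradiction pal
  ; old⊆      = there
  ; new∈      = here refl
  ; ⊆old      = λ { (here eq) → inj₂ (inj₁ eq) ; (there v∈) → inj₁ v∈ }
  }
... | no ¬pal = record
  { symmetric = pair ¬pal w∉ (w∉ ∘ Symmetric-reverse⁻ s) s
  ; orbits    = +-suc p k
  ; pairs     = n≤1+n k
  ; new-pair  = λ _ → refl
  ; old⊆      = there ∘ there
  ; new∈      = here refl
  ; ⊆old      = λ { (here eq) → inj₂ (inj₁ eq) ; (there (here eq)) → inj₂ (inj₂ eq)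
                  ; (there (there v∈)) → inj₁ v∈ }
  }

-- Factors

module _ (u : Word) where

  -- With this recursion the tail of a window is, by computation, the next shorter window: an edge
  -- of the Rauzy graph ends at its `tail`.
  window : (n i : ℕ) → FinWord n
  window zero    i = []
  window (suc n) i = u i ∷ window n (suc i)

  window-tabulate : ∀ n i → window n i ≡ tabulate (λ j → u (i + toℕ j))
  window-tabulate zero    i = refl
  window-tabulate (suc n) i = cong₂ _∷_ (cong u (sym (+-identityʳ i)))
    (trans (window-tabulate n (suc i)) (tabulate-cong λ j → cong u (sym (+-suc i (toℕ j)))))

  window-∷ʳ : ∀ n i → window (suc n) i ≡ window n i ∷ʳ u (i + n)
  window-∷ʳ zero    i = cong (λ k → u k ∷ []) (sym (+-identityʳ i))
  window-∷ʳ (suc n) i = cong (u i ∷_) (trans (window-∷ʳ n (suc i))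
    (cong (λ k → window n (suc i) ∷ʳ u k) (sym (+-suc i n))))

  window-factor : ∀ {n} i → Factor u n (window n i)
  window-factor {n} i = i , window-tabulate n i

  factor-window : ∀ {n w} → Factor u n w → ∃ λ i → w ≡ window n i
  factor-window {n} (i , eq) = i , trans eq (sym (window-tabulate n i))

  factor-tail : ∀ {n a w} → Factor u (suc n) (a ∷ w) → Factor u n w
  factor-tail fw with factor-window fw
  ... | i , refl = window-factor (suc i)

  factor-init : ∀ {n a} {w : FinWord n} → Factor u (suc n) (w ∷ʳ a) → Factor u n w
  factor-init {n} {a} {w} fw with factor-window fw
  ... | i , eq = subst (Factor u n) (sym (∷ʳ-injectiveˡ w _ (trans eq (window-∷ʳ n i))))
    (window-factor i)

  factor-extendʳ : ∀ {n w} → Factor u n w → ∃ λ a → Factor u (suc n) (w ∷ʳ a)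
  factor-extendʳ {n} fw with factor-window fw
  ... | i , refl = u (i + n) , subst (Factor u (suc n)) (window-∷ʳ n i) (window-factor i)

module Main (u : Word) (closed : ClosedUnderReversal u)
            (complexity : ∀ n → Complexity u n (2 * n + 1)) where

  -- Upper bound

  -- V and E are the factors of length n at positions ≤ N and those of length n + 1 at positions < N,
  -- together with their reversals. There are p + k orbits of vertices, and m orbits of edges that
  -- are not loops.
  record Visited (n N : ℕ) : Set where
    field
      {V}       : List (FinWord n)
      {E}       : List (FinWord (suc n))
      {p k q m} : ℕ
      symV      : Symmetric V p k
      symE      : Symmetric E q m
      visitedV  : ∀ {i} → i ≤ N → window u n i ∈ V
      visitedE  : ∀ {i} → i < N → window u (suc n) i ∈ E
      factorV   : ∀ {w} → w ∈ V → Factor u n w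
      factorE   : ∀ {w} → w ∈ E → Factor u (suc n) w
      endpoint  : ∀ {w} → w ∈ E → tail w ∈ V
      connected : p + k ≤ suc m

  factorInserted : ∀ {n w} {l : List (FinWord n)} → (∀ {v} → v ∈ l → Factor u n v) →
    Factor u n w → ∀ {v} → v ∈ l ⊎ v ≡ w ⊎ v ≡ reverse w → Factor u n v
  factorInserted fl fw (inj₁ v∈)          = fl v∈
  factorInserted fl fw (inj₂ (inj₁ refl)) = fw
  factorInserted fl fw (inj₂ (inj₂ refl)) = closed _ _ fw

  -- The reversed edge runs backwards, so it ends at the reversal of the vertex where the edge
  -- started.
  tail-reverse-window : ∀ n i → tail (reverse (window u (suc n) i)) ≡ reverse (window u n i)
  tail-reverse-window n i = cong tail
    (trans (cong reverse (window-∷ʳ u n i)) (reverse-∷ʳ (u (i + n)) (window u n i)))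

  -- Induction along the walk, starting from one vertex orbit and no edge. A new edge alone can only
  -- relax `connected`; a new vertex comes with a new edge that is not a loop, so both sides grow by
  -- one.
  visit : ∀ n N → Visited n N
  visit n zero = record
    { symV      = symmetric
    ; symE      = []
    ; visitedV  = λ { z≤n → new∈ }
    ; visitedE  = λ ()
    ; factorV   = factorInserted (λ ()) (window-factor u 0) ∘ ⊆old
    ; factorE   = λ ()
    ; endpoint  = λ ()
    ; connected = ≤-reflexive orbits
    }
    where open Insertion (insert (window u n 0) (λ ()) [])
  visit n (suc N) = step (window u n (suc N) ∈? V) (window u (suc n) N ∈? E)
    where
    open Visited (visit n N)
    v = window u n (suc N)
    e = window u (suc n) N

    reverse-e-endpoint : ∀ {V′} → V ⊆ V′ → tail (reverse e) ∈ V′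
    reverse-e-endpoint V⊆ = V⊆ (subst (_∈ V) (sym (tail-reverse-window n N))
      (Symmetric-reverse symV (visitedV ≤-refl)))

    extendV : ∀ {V′} → V ⊆ V′ → v ∈ V′ → ∀ {i} → i ≤ suc N → window u n i ∈ V′
    extendV V⊆ v∈ i≤ with m≤n⇒m<n∨m≡n i≤
    ... | inj₁ (s≤s i≤N) = V⊆ (visitedV i≤N)
    ... | inj₂ refl      = v∈

    extendE : ∀ {E′} → E ⊆ E′ → e ∈ E′ → ∀ {i} → i < suc N → window u (suc n) i ∈ E′
    extendE E⊆ e∈ (s≤s i≤) with m≤n⇒m<n∨m≡n i≤
    ... | inj₁ i<N  = E⊆ (visitedE i<N)
    ... | inj₂ refl = e∈

    extendEndpoint : ∀ {V′} → V ⊆ V′ → v ∈ V′ →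
      ∀ {w} → w ∈ E ⊎ w ≡ e ⊎ w ≡ reverse e → tail w ∈ V′
    extendEndpoint V⊆ v∈ (inj₁ w∈)          = V⊆ (endpoint w∈)
    extendEndpoint V⊆ v∈ (inj₂ (inj₁ refl)) = v∈
    extendEndpoint V⊆ v∈ (inj₂ (inj₂ refl)) = reverse-e-endpoint V⊆

    step : Dec (v ∈ V) → Dec (e ∈ E) → Visited n (suc N)
    step (yes v∈) (yes e∈) = record
      { symV = symV ; symE = symE
      ; visitedV = extendV (λ w∈ → w∈) v∈
      ; visitedE = extendE (λ w∈ → w∈) e∈
      ; factorV = factorV ; factorE = factorE
      ; endpoint = endpoint
      ; connected = connected
      }
    step (yes v∈) (no e∉) = record
      { symV = symV ; symE = I.symmetric
      ; visitedV = extendV (λ w∈ → w∈) v∈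
      ; visitedE = extendE I.old⊆ I.new∈
      ; factorV = factorV ; factorE = factorInserted factorE (window-factor u N) ∘ I.⊆old
      ; endpoint = extendEndpoint (λ w∈ → w∈) v∈ ∘ I.⊆old
      ; connected = ≤-trans connected (s≤s I.pairs)
      }
      where module I = Insertion (insert e e∉ symE)
    -- Since `tail e` computes to `v`, an edge seen before cannot lead to a new vertex.
    step (no v∉) (yes e∈) = contradiction (endpoint e∈) v∉
    step (no v∉) (no e∉) = record
      { symV = J.symmetric ; symE = I.symmetric
      ; visitedV = extendV J.old⊆ J.new∈
      ; visitedE = extendE I.old⊆ I.new∈
      ; factorV = factorInserted factorV (window-factor u (suc N)) ∘ J.⊆old
      ; factorE = factorInserted factorE (window-factor u N) ∘ I.⊆old
      ; endpoint = extendEndpoint J.old⊆ J.new∈ ∘ I.⊆old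
      ; connected = ≤-trans (≤-reflexive J.orbits)
          (s≤s (≤-trans connected (≤-reflexive (sym (I.new-pair e-not-loop)))))
      }
      where
      module I = Insertion (insert e e∉ symE)
      module J = Insertion (insert v v∉ symV)
      e-not-loop : ¬ IsPalindrome e
      -- For a palindrome `e`, the vertex `v` would be the reversal of the previous vertex, which
      -- already lies in `V`.
      e-not-loop pal = v∉ (subst (λ w → tail w ∈ V) pal (reverse-e-endpoint (λ w∈ → w∈)))

  -- Finitely many factors all occur before some position, so a long enough finite walk meets every
  -- vertex and every edge.
  position-bound : ∀ {n} (xs : List (FinWord n)) → (∀ {w} → w ∈ xs → Factor u n w) →
    ∃ λ N → ∀ {w} → w ∈ xs → ∃ λ i → i < N × w ≡ window u n i
  position-bound [] _ = 0 , λ ()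
  position-bound (x ∷ xs) fxs with factor-window u (fxs (here refl)) | position-bound xs (fxs ∘ there)
  ... | i , eq | N , bound = suc i ⊔ N , λ
    { (here refl) → i , m≤m⊔n (suc i) N , eq
    ; (there w∈)  → let j , j<N , eq′ = bound w∈ in j , ≤-trans j<N (m≤n⊔m (suc i) N) , eq′ }

  record Orbits (n : ℕ) : Set where
    field
      {p k q m} : ℕ
      card-n    : PalComplexity u n p
      card-1+n  : PalComplexity u (suc n) q
      split-n   : 2 * n + 1 ≡ p + 2 * k
      split-1+n : 2 * suc n + 1 ≡ q + 2 * m
      connected : p + k ≤ suc m

  orbits : ∀ n → Orbits n
  orbits n with complexity n | complexity (suc n)
  ... | xs , xs-len , uxs , xs⇔ | ys , ys-len , uys , ys⇔
      with position-bound xs (Equivalence.to (xs⇔ _)) | position-bound ys (Equivalence.to (ys⇔ _))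
  ... | M , xs-bound | N , ys-bound = record
    { card-n    = HasCard-resp-⇔ (λ w → mk⇔
        (λ { (w∈ , pw) → factorV w∈ , pw })
        (λ { (fw , pw) → xs⊆V (Equivalence.from (xs⇔ w) fw) , pw })) (Symmetric-palindromes symV)
    ; card-1+n  = HasCard-resp-⇔ (λ w → mk⇔
        (λ { (w∈ , pw) → factorE w∈ , pw })
        (λ { (fw , pw) → ys⊆E (Equivalence.from (ys⇔ w) fw) , pw })) (Symmetric-palindromes symE)
    ; split-n   = trans (sym xs-len) (trans
        (≤-antisym (Unique∧⊆⇒length≤ uxs xs⊆V)
          (Unique∧⊆⇒length≤ (Symmetric-unique symV) (Equivalence.from (xs⇔ _) ∘ factorV)))
        (Symmetric-length symV))
    ; split-1+n = trans (sym ys-len) (trans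
        (≤-antisym (Unique∧⊆⇒length≤ uys ys⊆E)
          (Unique∧⊆⇒length≤ (Symmetric-unique symE) (Equivalence.from (ys⇔ _) ∘ factorE)))
        (Symmetric-length symE))
    ; connected = connected
    }
    where
    open Visited (visit n (M ⊔ N))
    xs⊆V : xs ⊆ V
    xs⊆V w∈ with xs-bound w∈
    ... | i , i<M , refl = visitedV (≤-trans (<⇒≤ i<M) (m≤m⊔n M N))
    ys⊆E : ys ⊆ E
    ys⊆E w∈ with ys-bound w∈
    ... | i , i<N , refl = visitedE (≤-trans i<N (m≤n⊔m M N))

  -- Double `connected`: `2 * (p + k)` is C(n) + `p`, and `2 * m` is C(n+1) - `q`. Adding C(n) to
  -- the claim avoids subtraction.
  orbits⇒p+q≤4 : ∀ {n} (o : Orbits n) → Orbits.p o + Orbits.q o ≤ 4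
  orbits⇒p+q≤4 {n} o = +-cancelˡ-≤ (2 * n + 1) (p + q) 4 (begin
    2 * n + 1 + (p + q)          ≡⟨ cong (_+ (p + q)) split-n ⟩
    p + 2 * k + (p + q)          ≡⟨ solve 3 (λ p k q → p :+ con 2 :* k :+ (p :+ q)
                                      := con 2 :* (p :+ k) :+ q) refl p k q ⟩
    2 * (p + k) + q              ≤⟨ +-monoˡ-≤ q (*-monoʳ-≤ 2 connected) ⟩
    2 * suc m + q                ≡⟨ solve 2 (λ m q → con 2 :* (con 1 :+ m) :+ q
                                      := q :+ con 2 :* m :+ con 2) refl m q ⟩
    q + 2 * m + 2                ≡⟨ cong (_+ 2) (sym split-1+n) ⟩
    2 * suc n + 1 + 2            ≡⟨ solve 1 (λ n → con 2 :* (con 1 :+ n) :+ con 1 :+ con 2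
                                      := con 2 :* n :+ con 1 :+ con 4) refl n ⟩
    2 * n + 1 + 4                ∎)
    where
    open Orbits o
    open ≤-Reasoning
    open +-*-Solver

  -- Lower bound

  -- Reversal turns `w a` into `a w`: a palindrome has the same left and right extensions.
  ∷-factor : ∀ {n a w} → IsPalindrome w → Factor u (suc n) (w ∷ʳ a) → Factor u (suc n) (a ∷ w)
  ∷-factor {n} {a} {w} pal fw = subst (Factor u (suc n))
    (trans (reverse-∷ʳ a w) (cong (a ∷_) pal)) (closed _ _ fw)

  ∷ʳ-factor : ∀ {n a w} → IsPalindrome w → Factor u (suc n) (a ∷ w) → Factor u (suc n) (w ∷ʳ a)
  ∷ʳ-factor {n} {a} {w} pal fw = subst (Factor u (suc n))
    (trans (reverse-∷ a w) (cong (_∷ʳ a) pal)) (closed _ _ fw)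

  Inextensible : ∀ {n} → FinWord n → Set
  Inextensible {n} w = ∀ a → ¬ Factor u (suc (suc n)) (a ∷ (w ∷ʳ a))

  -- By reversal `a w` is a factor. It continues to some `a w c`, and `c` differs from `a` because
  -- `w` is inextensible.
  second-extension : ∀ {n a} {w : FinWord n} → IsPalindrome w → Inextensible w →
    Factor u (suc n) (w ∷ʳ a) → ∃ λ c → c ≢ a × Factor u (suc n) (w ∷ʳ c)
  second-extension {a = a} pal inext fwa with factor-extendʳ u (∷-factor pal fwa)
  ... | c , fawc = c , (λ { refl → inext a fawc }) , factor-tail u fawc

  -- All of `a`, `c`, `d` lie among `s` and `t`, while `c` and `d` both differ from `a`; so they
  -- coincide.
  two-extensions⇒deterministic : ∀ {n s t a c d} {w : FinWord n} → IsPalindrome w → Inextensible w →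
    (∀ {b} → Factor u (suc n) (w ∷ʳ b) → b ≡ s ⊎ b ≡ t) →
    Factor u (suc (suc n)) (a ∷ (w ∷ʳ c)) → Factor u (suc (suc n)) (a ∷ (w ∷ʳ d)) → c ≡ d
  two-extensions⇒deterministic pal inext only fc fd
    with only (∷ʳ-factor pal (factor-init u fc)) | only (factor-tail u fc) | only (factor-tail u fd)
  ... | inj₁ refl | inj₁ refl | _         = contradiction fc (inext _)
  ... | inj₁ refl | inj₂ refl | inj₁ refl = contradiction fd (inext _)
  ... | inj₁ refl | inj₂ refl | inj₂ refl = refl
  ... | inj₂ refl | inj₂ refl | _         = contradiction fc (inext _)
  ... | inj₂ refl | inj₁ refl | inj₂ refl = contradiction fd (inext _)
  ... | inj₂ refl | inj₁ refl | inj₁ refl = refl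

  -- The absence of right special factors of length `n`.
  Deterministic : ℕ → Set
  Deterministic n = ∀ {w a b} → Factor u (suc n) (w ∷ʳ a) → Factor u (suc n) (w ∷ʳ b) → a ≡ b

  -- Otherwise `init` would map the factors of length n + 1 injectively to those of length n,
  -- against C(n) < C(n+1).
  ¬deterministic : ∀ n → ¬ Deterministic n
  ¬deterministic n det with complexity n | complexity (suc n)
  ... | xs , xs-len , _ , xs⇔ | ys , ys-len , uys , ys⇔ = contradiction ys≤xs (<⇒≱ xs<ys)
    where
    init-injective : ∀ {v w} → v ∈ ys → w ∈ ys → init v ≡ init w → v ≡ w
    init-injective {v} {w} v∈ w∈ eq
      with initLast v | initLast w | Equivalence.to (ys⇔ v) v∈ | Equivalence.to (ys⇔ w) w∈
    init-injective v∈ w∈ refl | v , c , refl | _ , d , refl | fv | fw = cong (v ∷ʳ_) (det fv fw)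

    init⊆xs : map init ys ⊆ xs
    init⊆xs v∈ with ∈-map⁻ init v∈
    ... | w , w∈ , refl with initLast w | Equivalence.to (ys⇔ w) w∈
    ... | v , c , refl | fw = Equivalence.from (xs⇔ v) (factor-init u fw)

    ys≤xs : length ys ≤ length xs
    ys≤xs = ≤-trans (≤-reflexive (sym (length-map init ys)))
      (Unique∧⊆⇒length≤ (Unique-map init-injective uys) init⊆xs)

    xs<ys : length xs < length ys
    xs<ys = subst₂ _<_ (sym xs-len) (sym ys-len) (+-monoˡ-< 1 (*-monoʳ-< 2 (n<1+n n)))

  -- One chosen right extension per factor accounts for C(n) of the C(n) + 2 factors of length n +
  -- 1.
  Extender : ∀ n → (FinWord n → Alphabet) → Set
  Extender n next = ∀ {w} → Factor u n w → Factor u (suc n) (w ∷ʳ next w)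

  extender : ∀ n → ∃ (Extender n)
  extender n with complexity n
  ... | xs , _ , _ , xs⇔ = next , λ {w} → next-factor w
    where
    next : FinWord n → Alphabet
    next w with w ∈? xs
    ... | yes w∈ = proj₁ (factor-extendʳ u (Equivalence.to (xs⇔ w) w∈))
    -- An arbitrary letter: `Extender` constrains `next` on factors only.
    ... | no _   = zero

    next-factor : ∀ w → Factor u n w → Factor u (suc n) (w ∷ʳ next w)
    next-factor w fw with w ∈? xs
    ... | yes w∈ = proj₂ (factor-extendʳ u (Equivalence.to (xs⇔ w) w∈))
    ... | no w∉  = contradiction (Equivalence.from (xs⇔ w) fw) w∉

  module _ {n : ℕ} {next : FinWord n → Alphabet} (next-factor : Extender n next)
           {w₁ w₂ : FinWord n} {c₁ c₂ : Alphabet} (w₁≢w₂ : w₁ ≢ w₂)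
           (c₁≢ : c₁ ≢ next w₁) (f₁ : Factor u (suc n) (w₁ ∷ʳ c₁))
           (c₂≢ : c₂ ≢ next w₂) (f₂ : Factor u (suc n) (w₂ ∷ʳ c₂)) where

    -- The chosen extensions, `w₁ ∷ʳ c₁` and `w₂ ∷ʳ c₂` are C(n) + 2 = C(n+1) distinct factors,
    -- hence all of that length.
    classify : ∀ {v c} → Factor u (suc n) (v ∷ʳ c) →
      (v ≡ w₁ × c ≡ c₁) ⊎ (v ≡ w₂ × c ≡ c₂) ⊎ c ≡ next v
    classify {v} fvc with complexity n | complexity (suc n)
    ... | xs , xs-len , uxs , xs⇔ | ys , ys-len , uys , ys⇔ =
      resolve (ys⊆extensions (Equivalence.from (ys⇔ _) fvc))
      where
      extend : FinWord n → FinWord (suc n)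
      extend w = w ∷ʳ next w

      extensions : List (FinWord (suc n))
      extensions = (w₁ ∷ʳ c₁) ∷ (w₂ ∷ʳ c₂) ∷ map extend xs

      ∈-extend : ∀ {w c} → w ∷ʳ c ∈ map extend xs → c ≡ next w
      ∈-extend {w} w∈ with ∈-map⁻ extend w∈
      ... | w′ , _ , eq with ∷ʳ-injective w w′ eq
      ... | refl , eq′ = eq′

      extensions-unique : Unique extensions
      extensions-unique = ∉⇒Unique
        (λ { (here eq) → w₁≢w₂ (∷ʳ-injectiveˡ w₁ w₂ eq) ; (there w∈) → c₁≢ (∈-extend w∈) })
        (∉⇒Unique (c₂≢ ∘ ∈-extend) (map⁺ (λ {w} {w′} → ∷ʳ-injectiveˡ w w′) uxs))

      extensions⊆ys : extensions ⊆ ys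
      extensions⊆ys (here refl)         = Equivalence.from (ys⇔ _) f₁
      extensions⊆ys (there (here refl)) = Equivalence.from (ys⇔ _) f₂
      extensions⊆ys (there (there v∈)) with ∈-map⁻ extend v∈
      ... | w , w∈ , refl = Equivalence.from (ys⇔ _) (next-factor (Equivalence.to (xs⇔ w) w∈))

      ys⊆extensions : ys ⊆ extensions
      ys⊆extensions = Unique∧⊆∧length≥⇒⊇ _≟ʷ_ extensions-unique extensions⊆ys (≤-reflexive (begin
        length ys          ≡⟨ ys-len ⟩
        2 * suc n + 1      ≡⟨ cong (_+ 1) (*-distribˡ-+ 2 1 n) ⟩
        2 + (2 * n + 1)    ≡⟨ cong (2 +_) (sym (trans (length-map extend xs) xs-len)) ⟩
        length extensions  ∎))
        where open ≡-Reasoning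

      resolve : ∀ {c} → v ∷ʳ c ∈ extensions → (v ≡ w₁ × c ≡ c₁) ⊎ (v ≡ w₂ × c ≡ c₂) ⊎ c ≡ next v
      resolve (here eq)          = inj₁ (∷ʳ-injective v w₁ eq)
      resolve (there (here eq))  = inj₂ (inj₁ (∷ʳ-injective v w₂ eq))
      resolve (there (there v∈)) = inj₂ (inj₂ (∈-extend v∈))

    only₁ : ∀ {b} → Factor u (suc n) (w₁ ∷ʳ b) → b ≡ c₁ ⊎ b ≡ next w₁
    only₁ f with classify f
    ... | inj₁ (_ , eq)         = inj₁ eq
    ... | inj₂ (inj₁ (eq , _))  = contradiction eq w₁≢w₂
    ... | inj₂ (inj₂ eq)        = inj₂ eq

    only₂ : ∀ {b} → Factor u (suc n) (w₂ ∷ʳ b) → b ≡ c₂ ⊎ b ≡ next w₂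
    only₂ f with classify f
    ... | inj₁ (eq , _)         = contradiction (sym eq) w₁≢w₂
    ... | inj₂ (inj₁ (_ , eq))  = inj₁ eq
    ... | inj₂ (inj₂ eq)        = inj₂ eq

    only-other : ∀ {v b} → v ≢ w₁ → v ≢ w₂ → Factor u (suc n) (v ∷ʳ b) → b ≡ next v
    only-other v≢w₁ v≢w₂ f with classify f
    ... | inj₁ (eq , _)         = contradiction eq v≢w₁
    ... | inj₂ (inj₁ (eq , _))  = contradiction eq v≢w₂
    ... | inj₂ (inj₂ eq)        = eq

    -- Drop the first letter of the factor. What remains is `w₁` or `w₂`, where that letter decides
    -- the next one, or else has a single extension.
    inextensible⇒deterministic : IsPalindrome w₁ → IsPalindrome w₂ →
      Inextensible w₁ → Inextensible w₂ → Deterministic (suc n)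
    inextensible⇒deterministic pal₁ pal₂ inext₁ inext₂ {a ∷ v} fc fd with v ≟ʷ w₁ | v ≟ʷ w₂
    ... | yes refl | _        = two-extensions⇒deterministic pal₁ inext₁ only₁ fc fd
    ... | no _     | yes refl = two-extensions⇒deterministic pal₂ inext₂ only₂ fc fd
    ... | no v≢w₁  | no v≢w₂  = trans (only-other v≢w₁ v≢w₂ (factor-tail u fc))
                                      (sym (only-other v≢w₁ v≢w₂ (factor-tail u fd)))

  inextensible-unique : ∀ {n} {w₁ w₂ : FinWord n} → Factor u n w₁ → Factor u n w₂ →
    IsPalindrome w₁ → IsPalindrome w₂ → Inextensible w₁ → Inextensible w₂ → w₁ ≡ w₂
  inextensible-unique {n} {w₁} {w₂} f₁ f₂ pal₁ pal₂ inext₁ inext₂ with w₁ ≟ʷ w₂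
  ... | yes eq   = eq
  ... | no w₁≢w₂ =
    let next , next-factor = extender n
        c₁ , c₁≢ , f₁c₁    = second-extension pal₁ inext₁ (next-factor f₁)
        c₂ , c₂≢ , f₂c₂    = second-extension pal₂ inext₂ (next-factor f₂)
    in ⊥-elim (¬deterministic (suc n)
      (inextensible⇒deterministic next-factor w₁≢w₂ c₁≢ f₁c₁ c₂≢ f₂c₂ pal₁ pal₂ inext₁ inext₂))

  -- Any `a w a` with `w` a palindrome must be `t`, so only the word obtained from `t` by removing
  -- both end letters can be extensible. Two of the three palindromes differ from it and are
  -- inextensible.
  no-drop : ∀ {n} → PalComplexity u n 3 → ¬ PalComplexity u (suc (suc n)) 1
  no-drop {n} (x ∷ y ∷ z ∷ [] , refl , (x≢y ∷ x≢z ∷ []) ∷ (y≢z ∷ []) ∷ _ , xs⇔)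
    (t ∷ [] , refl , _ , ts⇔) = go (x ≟ʷ center) (y ≟ʷ center)
    where
    center : FinWord n
    center = init (tail t)

    inextensible : ∀ {w} → IsPalindrome w → w ≢ center → Inextensible w
    inextensible {w} pal w≢ a f with Equivalence.from (ts⇔ _) (f , palindrome-extension a pal)
    ... | here refl = w≢ (sym (init-∷ʳ a w))

    same : ∀ {v w} → v ∈ x ∷ y ∷ z ∷ [] → w ∈ x ∷ y ∷ z ∷ [] → v ≢ center → w ≢ center → v ≡ w
    same v∈ w∈ v≢ w≢ with Equivalence.to (xs⇔ _) v∈ | Equivalence.to (xs⇔ _) w∈
    ... | fv , pv | fw , pw =
      inextensible-unique fv fw pv pw (inextensible pv v≢) (inextensible pw w≢)

    x∈ = here refl
    y∈ = there (here refl)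
    z∈ = there (there (here refl))

    go : Dec (x ≡ center) → Dec (y ≡ center) → ⊥
    go (yes x≡) _        = y≢z (same y∈ z∈ (λ y≡ → x≢y (trans x≡ (sym y≡)))
                                           (λ z≡ → x≢z (trans x≡ (sym z≡))))
    go (no x≢)  (yes y≡) = x≢z (same x∈ z∈ x≢ (λ z≡ → y≢z (trans y≡ (sym z≡))))
    go (no x≢)  (no y≢)  = x≢y (same x∈ y∈ x≢ y≢)

  -- Parity and the alternation of 1 and 3

  odd≤4 : ∀ n p k → 2 * n + 1 ≡ p + 2 * k → p ≤ 4 → p ≡ 1 ⊎ p ≡ 3
  odd≤4 n p k eq p≤4 = go p (trans (+-comm 1 (2 * n)) eq) p≤4
    where
    go : ∀ p → suc (2 * n) ≡ p + 2 * k → p ≤ 4 → p ≡ 1 ⊎ p ≡ 3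
    go 0 eq _ = contradiction (sym eq) (even≢odd k n)
    go 1 eq _ = inj₁ refl
    go 2 eq _ = contradiction (trans (*-distribˡ-+ 2 1 k) (sym eq)) (even≢odd (1 + k) n)
    go 3 eq _ = inj₂ refl
    go 4 eq _ = contradiction (trans (*-distribˡ-+ 2 2 k) (sym eq)) (even≢odd (2 + k) n)
    go (suc (suc (suc (suc (suc _))))) _ (s≤s (s≤s (s≤s (s≤s ()))))

  odd-n : ∀ {n} (o : Orbits n) → Orbits.p o ≡ 1 ⊎ Orbits.p o ≡ 3
  odd-n {n} o = odd≤4 n p k split-n (m+n≤o⇒m≤o p (orbits⇒p+q≤4 o))
    where open Orbits o

  odd-1+n : ∀ {n} (o : Orbits n) → Orbits.q o ≡ 1 ⊎ Orbits.q o ≡ 3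
  odd-1+n {n} o = odd≤4 (suc n) q m split-1+n (m+n≤o⇒n≤o p (orbits⇒p+q≤4 o))
    where open Orbits o

  Alternating : ℕ → Set
  Alternating n = (PalComplexity u n 1 × PalComplexity u (suc n) 3)
                ⊎ (PalComplexity u n 3 × PalComplexity u (suc n) 1)

  palindromes-1 : PalComplexity u 1 3
  palindromes-1 = HasCard-resp-⇔ (λ { (_ ∷ []) → mk⇔ (_, refl) proj₁ }) (complexity 1)

  -- Induction: after (1,3) the bound 4 forces the next count down to 1; after (3,1) `no-drop`
  -- forces it back to 3.
  alternating : ∀ n → Alternating n
  alternating zero with orbits 0
  ... | o with odd-n o | HasCard-unique (Orbits.card-1+n o) palindromes-1
  ... | inj₁ refl | refl = inj₁ (Orbits.card-n o , Orbits.card-1+n o)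
  -- P(0) = 3 beside P(1) = 3 would exceed the bound 4.
  ... | inj₂ refl | refl = contradiction (orbits⇒p+q≤4 o) λ { (s≤s (s≤s (s≤s (s≤s ())))) }
  alternating (suc n) with alternating n | orbits (suc n)
  ... | inj₁ (_ , c) | o with HasCard-unique (Orbits.card-n o) c | odd-1+n o
  ... | refl | inj₁ refl = inj₂ (c , Orbits.card-1+n o)
  ... | refl | inj₂ refl = contradiction (orbits⇒p+q≤4 o) λ { (s≤s (s≤s (s≤s (s≤s ())))) }
  alternating (suc n) | inj₂ (b , c) | o with odd-1+n o
  ... | inj₁ refl = contradiction (Orbits.card-1+n o) (no-drop b)
  ... | inj₂ refl = inj₁ (c , Orbits.card-1+n o)

theorem1 : (u : Word) → ClosedUnderReversal u →
    (∀ n → Complexity u n (2 * n + 1)) →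
    ∀ n → Σ ℕ λ p → Σ ℕ λ q →
    PalComplexity u n p × PalComplexity u (suc n) q × (p + q ≡ 4)
theorem1 u closed complexity n with Main.alternating u closed complexity n
... | inj₁ (c , d) = 1 , 3 , c , d , refl
... | inj₂ (c , d) = 3 , 1 , c , d , refl
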